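{- Let $M$ be a set system on $[n]$. Then $M$ is a strong $\Delta$-matroid if and only if $\nu_M$ satisfies the peerless antipode equations $\mathcal G_n$ (i.e. satisfies every tropical equation in $\mathcal G_n$).
   Context: A set system on $[n]=\{1,\dots,n\}$ is a (possibly empty) collection of subsets of $[n]$; $\triangle$ is symmetric difference (when $a=b$, $\{a,b\}=\{a\}$). A $\Delta$-matroid is a set system $M$ such that for all $A,B\in M$ and $a\in A\triangle B$ there exists $b\in A\triangle B$ (possibly $b=a$) with $A\triangle\{a,b\}\in M$. A $\Delta$-matroid $M$ is strong if for all distinct $A,B\in M$ there exist (possibly equal) $a,b\in A\triangle B$ such that $A\triangle\{a,b\}\in M$ and $B\triangle\{a,b\}\in M$. Let $X=\{x_S:S\subseteq[n]\}$ be indeterminates and $\mathbb B=\{0,1\}$ the Boolean semifield ($1\oplus1=1$). A tropical equation is a formal sum $f=\bigoplus_{a\in A}X^{\odot a}$ with $A\subset\mathbb N^X$ finite (determined by the set $A$ of its monomials). It is satisfied by $p\in\mathbb B^X$ if the number of $a\in A$ such that $p(x_S)=1$ for all $x_S$ with $a(x_S)>0$ is not exactly $1$. For a set system $M$ on $[n]$, $\nu_M\in\mathbb B^X$ is defined by $\nu_M(x_S)=1$ iff $S\in M$. For $I,J\subseteq[n]$, the antipodes of the cube $\square_{I,J}=\operatorname{conv}\{\varepsilon_S: I\cap J\subseteq S\subseteq I\cup J\}$ ($\varepsilon_S\in\mathbb R^n$ the indicator vector of $S$) are the pairs $(\varepsilon_S,\varepsilon_T)$ with $S\cap T=I\cap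 J$ and $S\triangle T=I\triangle J$. Put $g_{I,J}=\bigoplus x_S\odot x_T$, the sum over all antipodes of $\square_{I,J}$ (each unordered pair $\{S,T\}$ contributing one monomial). The peerless antipode equations are $\mathcal G_n=\{g_{I,J}: I,J\subseteq[n],\ |I\triangle J|\ge3\}$. -}

module Defs where

open import Level using (Level; 0ℓ) renaming (suc to lsuc)
open import Data.Bool.Base using (Bool; true; if_then_else_)
import Data.Bool.Properties as Bool
open import Data.Fin.Base using (Fin)
open import Data.Fin.Subset using (Subset; inside; outside; ⁅_⁆; _∈_; _∩_; _∪_; _─_; ∣_∣)
open import Data.Fin.Subset.Properties using (anySubset?)
open import Data.List.Base
  using (List; []; _∷_; _++_; map; filter; length; deduplicate; cartesianProduct)
open import Data.List.Membership.Propositional using () renaming (_∈_ to _∈ˡ_)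
open import Data.List.Membership.Propositional.Properties using (∈-map⁺; ∈-++⁺ˡ; ∈-++⁺ʳ)
open import Data.List.Relation.Unary.Any using (here)
import Data.List.Relation.Unary.Unique.Setoid as Unique
open import Data.List.Relation.Unary.Unique.DecSetoid.Properties using (deduplicate-!)
open import Data.Nat.Base using (ℕ; zero; suc; _+_; _≤_; _<_)
import Data.Nat.Properties as ℕ
open import Data.Product.Base using (_×_; _,_; ∃; ∃₂)
import Data.Vec.Base as Vec
import Data.Vec.Properties as Vec
open import Relation.Binary.Bundles using (DecSetoid; Setoid)
open import Relation.Binary.Definitions using (DecidableEquality)
import Relation.Binary.Definitions as Binary
open import Relation.Binary.PropositionalEquality
  using (_≡_; _≢_; _≗_; refl; _→-setoid_)
open import Relation.Nullary.Decidable
  using (Dec; does; map′; ¬?; decidable-stable; _×-dec_; _→-dec_)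
open import Relation.Unary using (Pred; Decidable)

private
  variable
    ℓ : Level
    n : ℕ

infixl 6 _△_

_△_ : Subset n → Subset n → Subset n
A △ B = (A ─ B) ∪ (B ─ A)

-- When a = b this is the singleton {a}.
pair : Fin n → Fin n → Subset n
pair a b = ⁅ a ⁆ ∪ ⁅ b ⁆

_≟ˢ_ : DecidableEquality (Subset n)
_≟ˢ_ = Vec.≡-dec Bool._≟_

subsets : ∀ n → List (Subset n)
subsets zero    = Vec.[] ∷ []
subsets (suc n) = map (outside Vec.∷_) (subsets n) ++ map (inside Vec.∷_) (subsets n)

∈-subsets : (S : Subset n) → S ∈ˡ subsets n
∈-subsets Vec.[]              = here refl
∈-subsets (outside Vec.∷ S)   = ∈-++⁺ˡ (∈-map⁺ _ (∈-subsets S))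
∈-subsets {suc n} (inside Vec.∷ S) =
  ∈-++⁺ʳ (map (outside Vec.∷_) (subsets n)) (∈-map⁺ _ (∈-subsets S))

allSubset? : {P : Pred (Subset n) ℓ} → Decidable P → Dec (∀ S → P S)
allSubset? P? = map′
  (λ ¬∃¬ S → decidable-stable (P? S) λ ¬p → ¬∃¬ (S , ¬p))
  (λ ∀P (S , ¬p) → ¬p (∀P S))
  (¬? (anySubset? λ S → ¬? (P? S)))

SetSystem : ℕ → (ℓ : Level) → Set (lsuc ℓ)
SetSystem n ℓ = Pred (Subset n) ℓ

IsΔMatroid : SetSystem n ℓ → Set ℓ
IsΔMatroid M = ∀ {A B} → M A → M B → ∀ {a} → a ∈ A △ B →
  ∃ λ b → b ∈ A △ B × M (A △ pair a b)

record IsStrongΔMatroid {n ℓ} (M : SetSystem n ℓ) : Set ℓ where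
  field
    isΔMatroid     : IsΔMatroid M
    strongExchange : ∀ {A B} → M A → M B → A ≢ B →
      ∃₂ λ a b → a ∈ A △ B × b ∈ A △ B ×
                 M (A △ pair a b) × M (B △ pair a b)

-- An element of ℕ^X for the indeterminates X = { x_S : S ⊆ [n] }, given
-- by its exponents (S standing for x_S); monomials are identified
-- when their exponents agree pointwise.
Monomial : ℕ → Set
Monomial n = Subset n → ℕ

x : Subset n → Monomial n
x S U = if does (U ≟ˢ S) then 1 else 0

infixl 7 _⊙_

_⊙_ : Monomial n → Monomial n → Monomial n
(a ⊙ b) S = a S + b S

_≗?_ : Binary.Decidable {A = Monomial n} _≗_
a ≗? b = allSubset? λ S → a S ℕ.≟ b S

monomialDecSetoid : ℕ → DecSetoid 0ℓ 0ℓ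
monomialDecSetoid n = record
  { Carrier          = Monomial n
  ; _≈_              = _≗_
  ; isDecEquivalence = record
    { isEquivalence = Setoid.isEquivalence (Subset n →-setoid ℕ)
    ; _≟_           = _≗?_
    }
  }

-- The finite set of monomials is a list without repetitions.
record TropicalEquation (n : ℕ) : Set where
  field
    monomials : List (Monomial n)
    distinct  : Unique.Unique (DecSetoid.setoid (monomialDecSetoid n)) monomials

-- The formal sum whose set of monomials is the set of entries of the
-- list: repeated entries contribute a single monomial.
⨁ : List (Monomial n) → TropicalEquation n
⨁ {n} as = record
  { monomials = deduplicate _≗?_ as
  ; distinct  = deduplicate-! (monomialDecSetoid n) as
  }

-- Points of 𝔹^X, with true for 1 and false for 0.
Point : ℕ → Set
Point n = Subset n → Bool

NonVanishing : Point n → Monomial n → Set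
NonVanishing p a = ∀ S → 0 < a S → p S ≡ true

nonVanishing? : (p : Point n) → Decidable (NonVanishing p)
nonVanishing? p a = allSubset? λ S → (0 ℕ.<? a S) →-dec (p S Bool.≟ true)

_Satisfies_ : Point n → TropicalEquation n → Set
p Satisfies f = length (filter (nonVanishing? p) (TropicalEquation.monomials f)) ≢ 1

ν : {M : SetSystem n ℓ} → Decidable M → Point n
ν M? S = does (M? S)

-- The ordered pairs of antipodes of the cube □_{I,J}; its vertices ε_S are identified with the subsets S.
Antipodes : (I J : Subset n) → Pred (Subset n × Subset n) 0ℓ
Antipodes I J (S , T) = S ∩ T ≡ I ∩ J × S △ T ≡ I △ J

antipodes? : (I J : Subset n) → Decidable (Antipodes I J)
antipodes? I J (S , T) = ((S ∩ T) ≟ˢ (I ∩ J)) ×-dec ((S △ T) ≟ˢ (I △ J))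

antipodes : (I J : Subset n) → List (Subset n × Subset n)
antipodes {n} I J = filter (antipodes? I J) (cartesianProduct (subsets n) (subsets n))

-- Both (S , T) and (T , S) are listed, but x S ⊙ x T and x T ⊙ x S are
-- the same monomial, so ⨁ keeps one for each unordered pair.
g : (I J : Subset n) → TropicalEquation n
g I J = ⨁ (map (λ (S , T) → x S ⊙ x T) (antipodes I J))

𝒢 : ∀ n → Pred (TropicalEquation n) 0ℓ
𝒢 n f = ∃₂ λ (I J : Subset n) → 3 ≤ ∣ I △ J ∣ × f ≡ g I J

{-# OPTIONS --safe #-}

-- The even-size sets on [n] ∪ {0} that restrict to members of M form an even Δ-matroid if M
-- satisfies the Δ-matroid axiom and a one-element exchange across odd symmetric differences.
-- Both follow from the peerless equations by induction on |A △ B|: a second antipodal pair (C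
-- , D) of the cube of (A , B) splits A △ B into A △ C and A △ D, one of which contains a given
-- element, and one of which is odd if A △ B is. It remains to exchange simultaneously in two
-- members A and B of an even Δ-matroid. Suppose that no b exchanges with a in both. Let u
-- exchange with a in A and v with u in B. Induction for A and B △ {u,v}, and a matching
-- argument on four elements, show that v exchanges with a in B, and give a w exchanging with a
-- in A and with u in B. The same for w in place of v: w exchanges with a in B too.

module Submission where

open import Defs
open import Level using (Level)
open import Data.Bool.Base using (Bool; true; false; not; _xor_)
import Data.Bool.Properties as Bool
open import Data.Empty using (⊥-elim) renaming (⊥ to Empty)
open import Data.Fin.Base using (Fin; zero; suc)
import Data.Fin.Properties as Fin
open import Data.Fin.Subset
  using (Subset; ⊥; ⁅_⁆; Nonempty; _∈_; _∉_; _⊆_; _∩_; _∪_; _─_; ∣_∣)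
open import Data.Fin.Subset.Properties
open import Data.List.Base using (List; []; _∷_; map; filter; length; deduplicate; cartesianProduct)
import Data.List.Membership.Setoid as SetoidMembership
import Data.List.Membership.Setoid.Properties as SetoidMembershipₚ
open import Data.List.Membership.Propositional using () renaming (_∈_ to _∈ˡ_)
open import Data.List.Membership.Propositional.Properties
  using (∈-map⁺; ∈-map⁻; ∈-filter⁺; ∈-filter⁻; ∈-cartesianProduct⁺; ∈-deduplicate⁻)
open import Data.List.Relation.Unary.All using (_∷_)
open import Data.List.Relation.Unary.AllPairs using (_∷_)
open import Data.List.Relation.Unary.Any using (here; there) renaming (map to mapAny)
open import Data.List.Relation.Unary.Unique.Setoid using (Unique)
import Data.List.Relation.Unary.Unique.Setoid.Properties as Unique
open import Data.Nat.Base using (ℕ; zero; suc; _+_; _≤_; _<_; z≤n; s≤s)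
import Data.Nat.Properties as ℕ
open import Data.Nat.Induction using (Acc; acc; <-wellFounded)
open import Data.Product.Base using (_×_; _,_; ∃; ∃₂; proj₁; proj₂)
open import Data.Sum.Base using (_⊎_; inj₁; inj₂; [_,_]′) renaming (map to map-⊎)
open import Data.Vec.Base using ([]; _∷_; zipWith)
import Data.Vec.Base as Vec
import Data.Vec.Properties as Vec
open import Function.Base using (_∘_; id)
open import Function.Bundles using (_⇔_; mk⇔)
open import Relation.Binary.Bundles using (DecSetoid; Setoid)
open import Relation.Binary.PropositionalEquality
  using (_≡_; _≢_; _≗_; refl; sym; trans; cong; cong₂; subst; module ≡-Reasoning)
open import Relation.Nullary using (¬_; yes; no; contradiction)
open import Relation.Nullary.Decidable using (_×-dec_; ¬?; dec-true; dec-false)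
open import Relation.Unary using (Decidable)

private
  variable
    ℓ : Level
    n : ℕ
    A B D X Y Z S T I J : Subset n
    a b u v w : Fin n

-- Subsets as a Boolean group under symmetric difference

△-xor : (A B : Subset n) → A △ B ≡ zipWith _xor_ A B
△-xor []          []          = refl
△-xor (true ∷ A)  (true ∷ B)  = cong (false ∷_) (△-xor A B)
△-xor (true ∷ A)  (false ∷ B) = cong (true ∷_) (△-xor A B)
△-xor (false ∷ A) (true ∷ B)  = cong (true ∷_) (△-xor A B)
△-xor (false ∷ A) (false ∷ B) = cong (false ∷_) (△-xor A B)

△-comm : (A B : Subset n) → A △ B ≡ B △ A
△-comm A B = begin
  A △ B              ≡⟨ △-xor A B ⟩
  zipWith _xor_ A B  ≡⟨ Vec.zipWith-comm Bool.xor-comm A B ⟩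
  zipWith _xor_ B A  ≡⟨ △-xor B A ⟨
  B △ A              ∎
  where open ≡-Reasoning

△-assoc : (A B C : Subset n) → A △ B △ C ≡ A △ (B △ C)
△-assoc A B C = begin
  A △ B △ C                            ≡⟨ △-xor (A △ B) C ⟩
  zipWith _xor_ (A △ B) C              ≡⟨ cong (λ X → zipWith _xor_ X C) (△-xor A B) ⟩
  zipWith _xor_ (zipWith _xor_ A B) C  ≡⟨ Vec.zipWith-assoc Bool.xor-assoc A B C ⟩
  zipWith _xor_ A (zipWith _xor_ B C)  ≡⟨ cong (zipWith _xor_ A) (△-xor B C) ⟨
  zipWith _xor_ A (B △ C)              ≡⟨ △-xor A (B △ C) ⟨
  A △ (B △ C)                          ∎
  where open ≡-Reasoning

△-identityʳ : (A : Subset n) → A △ ⊥ ≡ A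
△-identityʳ A = trans (△-xor A ⊥) (Vec.zipWith-identityʳ Bool.xor-identityʳ A)

△-self : (A : Subset n) → A △ A ≡ ⊥
△-self []          = refl
△-self (true ∷ A)  = cong (false ∷_) (△-self A)
△-self (false ∷ A) = cong (false ∷_) (△-self A)

△-cancelʳ : (A B : Subset n) → A △ B △ B ≡ A
△-cancelʳ A B = begin
  A △ B △ B    ≡⟨ △-assoc A B B ⟩
  A △ (B △ B)  ≡⟨ cong (A △_) (△-self B) ⟩
  A △ ⊥        ≡⟨ △-identityʳ A ⟩
  A            ∎
  where open ≡-Reasoning

△-cancelˡ : (A B : Subset n) → A △ (A △ B) ≡ B
△-cancelˡ A B = begin
  A △ (A △ B)  ≡⟨ △-comm A (A △ B) ⟩
  A △ B △ A    ≡⟨ cong (_△ A) (△-comm A B) ⟩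
  B △ A △ A    ≡⟨ △-cancelʳ B A ⟩
  B            ∎
  where open ≡-Reasoning

△-swap : (A B C : Subset n) → A △ B △ C ≡ A △ C △ B
△-swap A B C = begin
  A △ B △ C    ≡⟨ △-assoc A B C ⟩
  A △ (B △ C)  ≡⟨ cong (A △_) (△-comm B C) ⟩
  A △ (C △ B)  ≡⟨ △-assoc A C B ⟨
  A △ C △ B    ∎
  where open ≡-Reasoning

△-interchange : (A B X : Subset n) → (A △ X) △ (B △ X) ≡ A △ B
△-interchange A B X = begin
  A △ X △ (B △ X)  ≡⟨ cong (A △ X △_) (△-comm B X) ⟩
  A △ X △ (X △ B)  ≡⟨ △-assoc (A △ X) X B ⟨
  A △ X △ X △ B    ≡⟨ cong (_△ B) (△-cancelʳ A X) ⟩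
  A △ B            ∎
  where open ≡-Reasoning

∈─⇒∉ : (A B : Subset n) → u ∈ A ─ B → u ∉ B
∈─⇒∉ (_ ∷ _) (true ∷ _)  ()              Vec.here
∈─⇒∉ (_ ∷ A) (true ∷ B)  (Vec.there u∈)  (Vec.there u∈B) = ∈─⇒∉ A B u∈ u∈B
∈─⇒∉ (_ ∷ A) (false ∷ B) (Vec.there u∈)  (Vec.there u∈B) = ∈─⇒∉ A B u∈ u∈B

∈△⁺ˡ : u ∈ A → u ∉ B → u ∈ A △ B
∈△⁺ˡ u∈A u∉B = x∈p∪q⁺ (inj₁ (x∈p∧x∉q⇒x∈p─q u∈A u∉B))

∈△⁺ʳ : u ∉ A → u ∈ B → u ∈ A △ B
∈△⁺ʳ u∉A u∈B = x∈p∪q⁺ (inj₂ (x∈p∧x∉q⇒x∈p─q u∈B u∉A))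

∈△⁻ : (A B : Subset n) → u ∈ A △ B → (u ∈ A × u ∉ B) ⊎ (u ∉ A × u ∈ B)
∈△⁻ A B u∈ with x∈p∪q⁻ (A ─ B) (B ─ A) u∈
... | inj₁ u∈A─B = inj₁ (p─q⊆p A B u∈A─B , ∈─⇒∉ A B u∈A─B)
... | inj₂ u∈B─A = inj₂ (∈─⇒∉ B A u∈B─A , p─q⊆p B A u∈B─A)

∈△⊆⁻ : X ⊆ D → u ∈ D △ X → u ∈ D × u ∉ X
∈△⊆⁻ {X = X} {D = D} X⊆D u∈ with ∈△⁻ D X u∈
... | inj₁ u∈D,u∉X         = u∈D,u∉X
... | inj₂ (u∉D , u∈X)     = contradiction (X⊆D u∈X) u∉D

⁅⁆⊆ : u ∈ D → ⁅ u ⁆ ⊆ D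
⁅⁆⊆ {u = u} u∈D v∈⁅u⁆ with refl ← x∈⁅y⁆⇒x≡y u v∈⁅u⁆ = u∈D

△-⊆-< : X ⊆ D → Nonempty X → ∣ D △ X ∣ < ∣ D ∣
△-⊆-< X⊆D (u , u∈X) = p⊂q⇒∣p∣<∣q∣
  (proj₁ ∘ ∈△⊆⁻ X⊆D , u , X⊆D u∈X , λ u∈ → proj₂ (∈△⊆⁻ X⊆D u∈) u∈X)

△-Empty : (A B : Subset n) → ¬ Nonempty (A △ B) → A ≡ B
△-Empty A B ∅ = begin
  A            ≡⟨ △-cancelˡ B A ⟨
  B △ (B △ A)  ≡⟨ cong (B △_) (△-comm B A) ⟩
  B △ (A △ B)  ≡⟨ cong (B △_) (Empty-unique ∅) ⟩
  B △ ⊥        ≡⟨ △-identityʳ B ⟩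
  B            ∎
  where open ≡-Reasoning

△-Nonempty : A ≢ B → Nonempty (A △ B)
△-Nonempty {A = A} {B = B} A≢B with nonempty? (A △ B)
... | yes ne = ne
... | no ∅   = contradiction (△-Empty A B ∅) A≢B

-- Toggling a single element

infixl 6 _⊕_

opaque
  -- Opaque because △ mentions both its arguments twice, so that unfolding iterated exchanges is
  -- expensive.
  _⊕_ : Subset n → Fin n → Subset n
  A ⊕ u = A △ ⁅ u ⁆

  △-⁅⁆ : (A : Subset n) (u : Fin n) → A △ ⁅ u ⁆ ≡ A ⊕ u
  △-⁅⁆ A u = refl

  ⊕-swap : (A : Subset n) (u v : Fin n) → A ⊕ u ⊕ v ≡ A ⊕ v ⊕ u
  ⊕-swap A u v = △-swap A ⁅ u ⁆ ⁅ v ⁆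

  ⊕-cancel : (A : Subset n) (u : Fin n) → A ⊕ u ⊕ u ≡ A
  ⊕-cancel A u = △-cancelʳ A ⁅ u ⁆

  △-⊕-assoc : (A D : Subset n) (u : Fin n) → A △ D ⊕ u ≡ A △ (D ⊕ u)
  △-⊕-assoc A D u = △-assoc A D ⁅ u ⁆

  ∈⊕⁺ : v ∈ D → v ≢ u → v ∈ D ⊕ u
  ∈⊕⁺ v∈D v≢u = ∈△⁺ˡ v∈D (x≢y⇒x∉⁅y⁆ v≢u)

  ∈⊕⁻ : (D : Subset n) (u : Fin n) → v ∈ D ⊕ u → v ∈ D ⊎ v ≡ u
  ∈⊕⁻ D u v∈ with ∈△⁻ D ⁅ u ⁆ v∈
  ... | inj₁ (v∈D , _) = inj₁ v∈D
  ... | inj₂ (_ , v∈u) = inj₂ (x∈⁅y⁆⇒x≡y u v∈u)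

  ∈⊕-member⁻ : u ∈ D → v ∈ D ⊕ u → v ∈ D × v ≢ u
  ∈⊕-member⁻ u∈D v∈ with v∈D , v∉⁅u⁆ ← ∈△⊆⁻ (⁅⁆⊆ u∈D) v∈ = v∈D , x∉⁅y⁆⇒x≢y v∉⁅u⁆

  ⊕-< : u ∈ D → ∣ D ⊕ u ∣ < ∣ D ∣
  ⊕-< {u = u} u∈D = △-⊆-< (⁅⁆⊆ u∈D) (u , x∈⁅x⁆ u)

  ⊕-Empty : (D : Subset n) (u : Fin n) → ¬ Nonempty (D ⊕ u) → D ≡ ⁅ u ⁆
  ⊕-Empty D u = △-Empty D ⁅ u ⁆

  △-pair : (A : Subset n) → u ≢ v → A △ pair u v ≡ A ⊕ u ⊕ v
  △-pair {u = u} {v = v} A u≢v =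
    trans (cong (A △_) (⊆-antisym to from)) (sym (△-assoc A ⁅ u ⁆ ⁅ v ⁆))
    where
    to : pair u v ⊆ ⁅ u ⁆ △ ⁅ v ⁆
    to x∈ with x∈p∪q⁻ ⁅ u ⁆ ⁅ v ⁆ x∈
    ... | inj₁ x∈u with refl ← x∈⁅y⁆⇒x≡y u x∈u = ∈△⁺ˡ x∈u (x≢y⇒x∉⁅y⁆ u≢v)
    ... | inj₂ x∈v with refl ← x∈⁅y⁆⇒x≡y v x∈v = ∈△⁺ʳ (x≢y⇒x∉⁅y⁆ (u≢v ∘ sym)) x∈v
    from : ⁅ u ⁆ △ ⁅ v ⁆ ⊆ pair u v
    from x∈ with ∈△⁻ ⁅ u ⁆ ⁅ v ⁆ x∈
    ... | inj₁ (x∈u , _) = x∈p∪q⁺ (inj₁ x∈u)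
    ... | inj₂ (_ , x∈v) = x∈p∪q⁺ (inj₂ x∈v)

  △-pair-self : (A : Subset n) (u : Fin n) → A △ pair u u ≡ A ⊕ u
  △-pair-self A u = cong (A △_) (∪-idem ⁅ u ⁆)

△-⊕⊕-assoc : (A D : Subset n) (u v : Fin n) → A △ D ⊕ u ⊕ v ≡ A △ (D ⊕ u ⊕ v)
△-⊕⊕-assoc A D u v = trans (cong (_⊕ v) (△-⊕-assoc A D u)) (△-⊕-assoc A (D ⊕ u) v)

-- Sizes one and two are the base cases of the inductions on `∣ D ∣` below, since the peerless
-- hypothesis begins at size three.
classify-size : u ∈ D →
  D ≡ ⁅ u ⁆ ⊎ (∃ λ v → v ∈ D × v ≢ u × D ≡ ⁅ u ⁆ ⊕ v) ⊎ 3 ≤ ∣ D ∣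
classify-size {u = u} {D = D} u∈D with nonempty? (D ⊕ u)
... | no ∅ = inj₁ (⊕-Empty D u ∅)
... | yes (v , v∈Du) with nonempty? (D ⊕ v ⊕ u)
...   | no ∅ = let v∈D , v≢u = ∈⊕-member⁻ u∈D v∈Du in
  inj₂ (inj₁ (v , v∈D , v≢u , trans (sym (⊕-cancel D v)) (cong (_⊕ v) (⊕-Empty (D ⊕ v) u ∅))))
...   | yes (w , w∈) = let v∈D , v≢u = ∈⊕-member⁻ u∈D v∈Du in
  inj₂ (inj₂ (ℕ.≤-trans (s≤s (ℕ.≤-trans (s≤s (ℕ.≤-trans (s≤s z≤n)
    (⊕-< w∈))) (⊕-< (∈⊕⁺ u∈D (v≢u ∘ sym))))) (⊕-< v∈D)))

-- Symmetric exchange in even Δ-matroids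

-- Choosing one edge from each perfect matching of K₄ on {a,u,v,w} gives a star or a triangle,
-- so a set of edges meeting all four stars and all four triangles contains a perfect matching.
K₄-matching : {AU AV AW UV UW VW : Set ℓ} →
  AU ⊎ AV ⊎ AW → AU ⊎ UV ⊎ UW → AV ⊎ UV ⊎ VW → AW ⊎ UW ⊎ VW →
  VW ⊎ UW ⊎ UV → VW ⊎ AW ⊎ AV → UW ⊎ AW ⊎ AU → UV ⊎ AV ⊎ AU →
  (AU × VW) ⊎ (AV × UW) ⊎ (AW × UV)
K₄-matching {AU = AU} {AV} {AW} {UV} {UW} {VW} *a *u *v *w ▵a ▵u ▵v ▵w = [ au , [ av , aw ]′ ]′ *a
  where
  Matching = (AU × VW) ⊎ (AV × UW) ⊎ (AW × UV)
  m₁ : AU → VW → Matching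
  m₁ p q = inj₁ (p , q)
  m₂ : AV → UW → Matching
  m₂ p q = inj₂ (inj₁ (p , q))
  m₃ : AW → UV → Matching
  m₃ p q = inj₂ (inj₂ (p , q))
  au-av-aw : AU → AV → AW → Matching
  au-av-aw p q r = [ m₁ p , [ m₂ q , m₃ r ]′ ]′ ▵a
  au-av : AU → AV → Matching
  au-av p q = [ au-av-aw p q , [ m₂ q , m₁ p ]′ ]′ *w
  au-aw : AU → AW → Matching
  au-aw p r = [ (λ q → au-av-aw p q r) , [ m₃ r , m₁ p ]′ ]′ *v
  av-aw : AV → AW → Matching
  av-aw q r = [ (λ p → au-av-aw p q r) , [ m₃ r , m₂ q ]′ ]′ *u
  au : AU → Matching
  au p = [ m₁ p , [ au-aw p , au-av p ]′ ]′ ▵u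
  av : AV → Matching
  av q = [ m₂ q , [ av-aw q , (λ p → au-av p q) ]′ ]′ ▵v
  aw : AW → Matching
  aw r = [ m₃ r , [ (λ q → av-aw q r) , (λ p → au-aw p r) ]′ ]′ ▵w

-- Members of an even Δ-matroid differ in evenly many elements, which forces the partner of `u` to
-- be a second element. The other member is written `A △ D` so that induction can run on `∣ D ∣`.
EvenExchange : SetSystem n ℓ → Set ℓ
EvenExchange F = ∀ {A D} → F A → F (A △ D) → ∀ {u} → u ∈ D →
  ∃ λ v → v ∈ D × v ≢ u × F (A ⊕ u ⊕ v)

module _ {F : SetSystem n ℓ} (exchange : EvenExchange F) where

  exchange′ : F A → F (A △ D) → u ∈ D → ∃ λ v → v ∈ D × v ≢ u × F (A △ D ⊕ u ⊕ v)
  exchange′ {A = A} {D = D} FA FB = exchange FB (subst F (sym (△-cancelʳ A D)) FA)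

  swap : (A : Subset n) (u v : Fin n) → F (A ⊕ u ⊕ v) → F (A ⊕ v ⊕ u)
  swap A u v = subst F (⊕-swap A u v)

  -- Let an edge `xy` on the four elements mean that `A ⊕ x ⊕ y` is a member. The difference of the
  -- two given members contains `a` and nothing beyond the four elements, so exchanging `a` in `A`
  -- yields an edge at `a`.
  star : a ≢ u → a ≢ v → a ≢ w →
    F A → F (A ⊕ a ⊕ u ⊕ v ⊕ w) → F (A ⊕ a ⊕ u) ⊎ F (A ⊕ a ⊕ v) ⊎ F (A ⊕ a ⊕ w)
  star {a = a} {u = u} {v = v} {w = w} {A = A} a≢u a≢v a≢w FA FB
    with exchange FA (subst F eq FB) (∈⊕⁺ (∈⊕⁺ (∈⊕⁺ (x∈⁅x⁆ a) a≢u) a≢v) a≢w)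
    where
    eq : A ⊕ a ⊕ u ⊕ v ⊕ w ≡ A △ (⁅ a ⁆ ⊕ u ⊕ v ⊕ w)
    eq = begin
      A ⊕ a ⊕ u ⊕ v ⊕ w        ≡⟨ cong (λ S → S ⊕ u ⊕ v ⊕ w) (△-⁅⁆ A a) ⟨
      A △ ⁅ a ⁆ ⊕ u ⊕ v ⊕ w    ≡⟨ cong (_⊕ w) (△-⊕⊕-assoc A ⁅ a ⁆ u v) ⟩
      A △ (⁅ a ⁆ ⊕ u ⊕ v) ⊕ w  ≡⟨ △-⊕-assoc A (⁅ a ⁆ ⊕ u ⊕ v) w ⟩
      A △ (⁅ a ⁆ ⊕ u ⊕ v ⊕ w)  ∎
      where open ≡-Reasoning
  ... | x , x∈ , x≢a , Fx with ∈⊕⁻ (⁅ a ⁆ ⊕ u ⊕ v) w x∈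
  ... | inj₂ refl = inj₂ (inj₂ Fx)
  ... | inj₁ x∈auv with ∈⊕⁻ (⁅ a ⁆ ⊕ u) v x∈auv
  ...   | inj₂ refl = inj₂ (inj₁ Fx)
  ...   | inj₁ x∈au with ∈⊕⁻ ⁅ a ⁆ u x∈au
  ...     | inj₂ refl = inj₁ Fx
  ...     | inj₁ x∈a  = contradiction (x∈⁅y⁆⇒x≡y a x∈a) x≢a

  -- This is `star` seen from the far member: toggling `a` and `u` there leaves `A ⊕ v ⊕ w`, so an
  -- edge at `a` for that member is the complementary edge for `A`.
  triangle : a ≢ u → a ≢ v → a ≢ w →
    F A → F (A ⊕ a ⊕ u ⊕ v ⊕ w) → F (A ⊕ v ⊕ w) ⊎ F (A ⊕ u ⊕ w) ⊎ F (A ⊕ u ⊕ v)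
  triangle {a = a} {u = u} {v = v} {w = w} {A = A} a≢u a≢v a≢w FA FB =
    map-⊎ (subst F eq-u) (map-⊎ (subst F eq-v) (subst F eq-w))
      (star a≢u a≢v a≢w FB (subst F (sym eq) FA))
    where
    open ≡-Reasoning
    drop-a : A ⊕ a ⊕ u ⊕ v ⊕ w ⊕ a ≡ A ⊕ u ⊕ v ⊕ w
    drop-a = begin
      A ⊕ a ⊕ u ⊕ v ⊕ w ⊕ a  ≡⟨ ⊕-swap (A ⊕ a ⊕ u ⊕ v) w a ⟩
      A ⊕ a ⊕ u ⊕ v ⊕ a ⊕ w  ≡⟨ cong (_⊕ w) (⊕-swap (A ⊕ a ⊕ u) v a) ⟩
      A ⊕ a ⊕ u ⊕ a ⊕ v ⊕ w  ≡⟨ cong (λ S → S ⊕ v ⊕ w) (⊕-swap (A ⊕ a) u a) ⟩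
      A ⊕ a ⊕ a ⊕ u ⊕ v ⊕ w  ≡⟨ cong (λ S → S ⊕ u ⊕ v ⊕ w) (⊕-cancel A a) ⟩
      A ⊕ u ⊕ v ⊕ w          ∎
    eq-w : A ⊕ a ⊕ u ⊕ v ⊕ w ⊕ a ⊕ w ≡ A ⊕ u ⊕ v
    eq-w = trans (cong (_⊕ w) drop-a) (⊕-cancel (A ⊕ u ⊕ v) w)
    eq-v : A ⊕ a ⊕ u ⊕ v ⊕ w ⊕ a ⊕ v ≡ A ⊕ u ⊕ w
    eq-v = begin
      A ⊕ a ⊕ u ⊕ v ⊕ w ⊕ a ⊕ v  ≡⟨ cong (_⊕ v) drop-a ⟩
      A ⊕ u ⊕ v ⊕ w ⊕ v          ≡⟨ cong (_⊕ v) (⊕-swap (A ⊕ u) v w) ⟩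
      A ⊕ u ⊕ w ⊕ v ⊕ v          ≡⟨ ⊕-cancel (A ⊕ u ⊕ w) v ⟩
      A ⊕ u ⊕ w                  ∎
    eq-u : A ⊕ a ⊕ u ⊕ v ⊕ w ⊕ a ⊕ u ≡ A ⊕ v ⊕ w
    eq-u = begin
      A ⊕ a ⊕ u ⊕ v ⊕ w ⊕ a ⊕ u  ≡⟨ cong (_⊕ u) drop-a ⟩
      A ⊕ u ⊕ v ⊕ w ⊕ u          ≡⟨ ⊕-swap (A ⊕ u ⊕ v) w u ⟩
      A ⊕ u ⊕ v ⊕ u ⊕ w          ≡⟨ cong (_⊕ w) (⊕-swap (A ⊕ u) v u) ⟩
      A ⊕ u ⊕ u ⊕ v ⊕ w          ≡⟨ cong (λ S → S ⊕ v ⊕ w) (⊕-cancel A u) ⟩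
      A ⊕ v ⊕ w                  ∎
    eq : A ⊕ a ⊕ u ⊕ v ⊕ w ⊕ a ⊕ u ⊕ v ⊕ w ≡ A
    eq = begin
      A ⊕ a ⊕ u ⊕ v ⊕ w ⊕ a ⊕ u ⊕ v ⊕ w  ≡⟨ cong (λ S → S ⊕ v ⊕ w) eq-u ⟩
      A ⊕ v ⊕ w ⊕ v ⊕ w                  ≡⟨ cong (_⊕ w) (⊕-swap (A ⊕ v) w v) ⟩
      A ⊕ v ⊕ v ⊕ w ⊕ w                  ≡⟨ ⊕-cancel (A ⊕ v ⊕ v) w ⟩
      A ⊕ v ⊕ v                          ≡⟨ ⊕-cancel A v ⟩
      A                                  ∎

  -- Reordering toggles lets each of the four elements take the role of `a`, which supplies the
  -- eight hypotheses of `K₄-matching`.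
  matching : a ≢ u → a ≢ v → a ≢ w → u ≢ v → u ≢ w → v ≢ w →
    F A → F (A ⊕ a ⊕ u ⊕ v ⊕ w) →
    (F (A ⊕ a ⊕ u) × F (A ⊕ v ⊕ w)) ⊎
    (F (A ⊕ a ⊕ v) × F (A ⊕ u ⊕ w)) ⊎
    (F (A ⊕ a ⊕ w) × F (A ⊕ u ⊕ v))
  matching {a = a} {u = u} {v = v} {w = w} {A = A} a≢u a≢v a≢w u≢v u≢w v≢w FA FB =
    K₄-matching
      (star a≢u a≢v a≢w FA FB)
      (map-⊎ (swap A u a) id (star u≢a u≢v u≢w FA FB-u))
      (map-⊎ (swap A v a) (map-⊎ (swap A v u) id) (star v≢a v≢u v≢w FA FB-v))
      (map-⊎ (swap A w a) (map-⊎ (swap A w u) (swap A w v)) (star w≢a w≢u w≢v FA FB-w))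
      (triangle a≢u a≢v a≢w FA FB)
      (triangle u≢a u≢v u≢w FA FB-u)
      (triangle v≢a v≢u v≢w FA FB-v)
      (triangle w≢a w≢u w≢v FA FB-w)
    where
    FB-u : F (A ⊕ u ⊕ a ⊕ v ⊕ w)
    FB-u = subst F (cong (λ S → S ⊕ v ⊕ w) (⊕-swap A a u)) FB
    FB-v : F (A ⊕ v ⊕ a ⊕ u ⊕ w)
    FB-v = subst F (cong (_⊕ w)
             (trans (⊕-swap (A ⊕ a) u v) (cong (_⊕ u) (⊕-swap A a v)))) FB
    FB-w : F (A ⊕ w ⊕ a ⊕ u ⊕ v)
    FB-w = subst F (trans (⊕-swap (A ⊕ a ⊕ u) v w) (cong (_⊕ v)
             (trans (⊕-swap (A ⊕ a) u w) (cong (_⊕ u) (⊕-swap A a w))))) FB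
    u≢a = a≢u ∘ sym ; v≢a = a≢v ∘ sym ; w≢a = a≢w ∘ sym
    v≢u = u≢v ∘ sym ; w≢u = u≢w ∘ sym ; w≢v = v≢w ∘ sym

  symmetricExchange : Decidable F → Acc _<_ ∣ D ∣ → F A → F (A △ D) → a ∈ D →
    ∃ λ b → b ∈ D × b ≢ a × F (A ⊕ a ⊕ b) × F (A △ D ⊕ a ⊕ b)
  symmetricExchange {D = D} {A = A} {a = a} F? (acc rs) FA FB a∈D
    -- Decidability permits a proof by contradiction: a failed search means that `a` has no common
    -- partner.
    with Fin.any? (λ b → b ∈? D ×-dec ¬? (b Fin.≟ a)
           ×-dec F? (A ⊕ a ⊕ b) ×-dec F? (A △ D ⊕ a ⊕ b))
  ... | yes found = found
  ... | no  none  = ⊥-elim absurd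
    where
    disjoint : v ∈ D → v ≢ a → F (A ⊕ a ⊕ v) → ¬ F (A △ D ⊕ a ⊕ v)
    disjoint v∈D v≢a FAv FBv = none (_ , v∈D , v≢a , FAv , FBv)

    -- The induction hypothesis for `A` and `A △ D ⊕ u ⊕ v`, whose difference still contains `a`,
    -- supplies `w`. Then `matching` applies to `A △ D` and its toggle by `u`, `v`, `a`, `w`.
    descend : u ∈ D → v ∈ D → u ≢ a → v ≢ a → v ≢ u →
      F (A ⊕ a ⊕ u) → F (A △ D ⊕ u ⊕ v) →
      F (A △ D ⊕ a ⊕ v) ×
      ∃ λ w → w ∈ D × w ≢ a × w ≢ u × F (A ⊕ a ⊕ w) × F (A △ D ⊕ u ⊕ w)
    descend {u = u} {v = v} u∈D v∈D u≢a v≢a v≢u FAu FBuv =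
      let v∈Du = ∈⊕⁺ v∈D v≢u
          w , w∈ , w≢a , FAw , FBuvaw =
            symmetricExchange F? (rs (ℕ.<-trans (⊕-< v∈Du) (⊕-< u∈D))) FA
              (subst F (△-⊕⊕-assoc A D u v) FBuv)
              (∈⊕⁺ (∈⊕⁺ a∈D (u≢a ∘ sym)) (v≢a ∘ sym))
          w∈Du , w≢v = ∈⊕-member⁻ v∈Du w∈
          w∈D , w≢u  = ∈⊕-member⁻ u∈D w∈Du
      -- The first two matchings would make `w` or `u` a common partner of `a`; the third pairs `u`
      -- with `w` and `v` with `a`.
      in [ (λ (_ , FBaw) → contradiction FBaw (disjoint w∈D w≢a FAw))
         , [ (λ (FBua , _) → contradiction (swap (A △ D) u a FBua) (disjoint u∈D u≢a FAu))
           , (λ (FBuw , FBva) → swap (A △ D) v a FBva , w , w∈D , w≢a , w≢u , FAw , FBuw)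
           ]′ ]′
         (matching (v≢u ∘ sym) u≢a (w≢u ∘ sym) v≢a (w≢v ∘ sym) (w≢a ∘ sym) FB
           (subst F (cong (λ S → S ⊕ a ⊕ w) (sym (△-⊕⊕-assoc A D u v))) FBuvaw))

    absurd : Empty
    absurd =
      let u , u∈D , u≢a , FAu  = exchange FA FB a∈D
          v , v∈D , v≢u , FBuv = exchange′ FA FB u∈D
          -- If `v` were `a`, then `FBuv` would make `u` a common partner of `a`.
          v≢a = λ v≡a → disjoint u∈D u≢a FAu
            (swap (A △ D) u a (subst (λ x → F (A △ D ⊕ u ⊕ x)) v≡a FBuv))
          -- The first use produces `w`; the second, with `w` in place of `v`, makes `w` a partner
          -- of `a` in `A △ D` as well as in `A`.
          _ , w , w∈D , w≢a , w≢u , FAw , FBuw = descend u∈D v∈D u≢a v≢a v≢u FAu FBuv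
          FBw , _ = descend u∈D w∈D u≢a w≢a w≢u FAu FBuw
      in disjoint w∈D w≢a FAw FBw

-- Parity and the even lift of a set system

parity : Subset n → Bool
parity []      = false
parity (s ∷ A) = s xor parity A

parity-△ : (A B : Subset n) → parity (A △ B) ≡ parity A xor parity B
parity-△ []          []          = refl
parity-△ (true ∷ A)  (true ∷ B)  = trans (parity-△ A B) (sym (not-xor-not (parity A) (parity B)))
  where
  not-xor-not : ∀ s t → not s xor not t ≡ s xor t
  not-xor-not true  t = refl
  not-xor-not false t = Bool.not-involutive t
parity-△ (true ∷ A)  (false ∷ B) =
  trans (cong not (parity-△ A B)) (Bool.not-distribˡ-xor (parity A) (parity B))
parity-△ (false ∷ A) (true ∷ B)  =
  trans (cong not (parity-△ A B)) (Bool.not-distribʳ-xor (parity A) (parity B))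
parity-△ (false ∷ A) (false ∷ B) = parity-△ A B

parity-⊥ : ∀ n → parity (⊥ {n}) ≡ false
parity-⊥ zero    = refl
parity-⊥ (suc n) = parity-⊥ n

parity-⁅⁆ : (u : Fin n) → parity ⁅ u ⁆ ≡ true
parity-⁅⁆ {suc n} zero    = cong not (parity-⊥ n)
parity-⁅⁆         (suc u) = parity-⁅⁆ u

parity-⊕ : (A : Subset n) (u : Fin n) → parity (A ⊕ u) ≡ not (parity A)
parity-⊕ A u = begin
  parity (A ⊕ u)               ≡⟨ cong parity (△-⁅⁆ A u) ⟨
  parity (A △ ⁅ u ⁆)           ≡⟨ parity-△ A ⁅ u ⁆ ⟩
  parity A xor parity ⁅ u ⁆    ≡⟨ cong (parity A xor_) (parity-⁅⁆ u) ⟩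
  parity A xor true            ≡⟨ Bool.xor-comm (parity A) true ⟩
  not (parity A)               ∎
  where open ≡-Reasoning

parity-⊕⊕ : (A : Subset n) (u v : Fin n) → parity (A ⊕ u ⊕ v) ≡ parity A
parity-⊕⊕ A u v = begin
  parity (A ⊕ u ⊕ v)    ≡⟨ parity-⊕ (A ⊕ u) v ⟩
  not (parity (A ⊕ u))  ≡⟨ cong not (parity-⊕ A u) ⟩
  not (not (parity A))  ≡⟨ Bool.not-involutive (parity A) ⟩
  parity A              ∎
  where open ≡-Reasoning

tail-△ : (A B : Subset (suc n)) → Vec.tail (A △ B) ≡ Vec.tail A △ Vec.tail B
tail-△ (_ ∷ A) (_ ∷ B) = refl

tail-⊕-zero : (A : Subset (suc n)) → Vec.tail (A ⊕ zero) ≡ Vec.tail A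
tail-⊕-zero A = begin
  Vec.tail (A ⊕ zero)      ≡⟨ cong Vec.tail (△-⁅⁆ A zero) ⟨
  Vec.tail (A △ ⁅ zero ⁆)  ≡⟨ tail-△ A ⁅ zero ⁆ ⟩
  Vec.tail A △ ⊥           ≡⟨ △-identityʳ (Vec.tail A) ⟩
  Vec.tail A               ∎
  where open ≡-Reasoning

tail-⊕-suc : (A : Subset (suc n)) (u : Fin n) → Vec.tail (A ⊕ suc u) ≡ Vec.tail A ⊕ u
tail-⊕-suc A u = begin
  Vec.tail (A ⊕ suc u)      ≡⟨ cong Vec.tail (△-⁅⁆ A (suc u)) ⟨
  Vec.tail (A △ ⁅ suc u ⁆)  ≡⟨ tail-△ A ⁅ suc u ⁆ ⟩
  Vec.tail A △ ⁅ u ⁆        ≡⟨ △-⁅⁆ (Vec.tail A) u ⟩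
  Vec.tail A ⊕ u            ∎
  where open ≡-Reasoning

-- The peerless equations in terms of sets: antipodes `A` and `A △ D` in `M` are accompanied by a
-- second pair. The nonemptiness conditions exclude `X` empty and `X` equal to `D`, which give the
-- same unordered pair again.
Peerless : SetSystem n ℓ → Set ℓ
Peerless M = ∀ {A D} → M A → M (A △ D) → 3 ≤ ∣ D ∣ →
  ∃ λ X → X ⊆ D × Nonempty X × Nonempty (D △ X) × M (A △ X) × M (A △ (D △ X))

-- A one-element exchange in M becomes a two-element exchange involving the new element.
EvenLift : SetSystem n ℓ → SetSystem (suc n) ℓ
EvenLift M A = M (Vec.tail A) × parity A ≡ false

module _ {M : SetSystem n ℓ} (peerless : Peerless M) where

  exchangeOneOrTwo : Acc _<_ ∣ D ∣ → M A → M (A △ D) → u ∈ D →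
    M (A ⊕ u) ⊎ ∃ λ v → v ∈ D × v ≢ u × M (A ⊕ u ⊕ v)
  exchangeOneOrTwo {D = D} {A = A} {u = u} (acc rs) MA MB u∈D with classify-size u∈D
  ... | inj₁ refl = inj₁ (subst M (△-⁅⁆ A u) MB)
  ... | inj₂ (inj₁ (v , v∈D , v≢u , refl)) = inj₂ (v , v∈D , v≢u ,
    subst M (trans (sym (△-⊕-assoc A ⁅ u ⁆ v)) (cong (_⊕ v) (△-⁅⁆ A u))) MB)
  ... | inj₂ (inj₂ 3≤D) with peerless MA MB 3≤D
  -- `X` and `D △ X` partition `D` into proper parts, so induction applies to the one containing
  -- `u`.
  ... | X , X⊆D , X≠∅ , (y , y∈) , MX , MX′ with u ∈? X
  ...   | yes u∈X = map-⊎ id (λ (v , v∈ , rest) → v , X⊆D v∈ , rest)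
    (exchangeOneOrTwo (rs (p⊂q⇒∣p∣<∣q∣ (X⊆D , y , ∈△⊆⁻ X⊆D y∈))) MA MX u∈X)
  ...   | no u∉X  = map-⊎ id (λ (v , v∈ , rest) → v , proj₁ (∈△⊆⁻ X⊆D v∈) , rest)
    (exchangeOneOrTwo (rs (△-⊆-< X⊆D X≠∅)) MA MX′ (∈△⁺ˡ u∈D u∉X))

  -- Odd parity rules out sizes zero and two, and it passes to exactly one part of each splitting,
  -- so the induction ends at a singleton.
  exchangeOne : Acc _<_ ∣ D ∣ → M A → M (A △ D) → parity D ≡ true →
    ∃ λ v → v ∈ D × M (A ⊕ v)
  exchangeOne {D = D} {A = A} (acc rs) MA MB odd with nonempty? D
  ... | no ∅ = contradiction
    (trans (sym odd) (trans (cong parity (Empty-unique ∅)) (parity-⊥ n))) λ ()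
  ... | yes (u , u∈D) with classify-size u∈D
  ... | inj₁ refl = u , u∈D , subst M (△-⁅⁆ A u) MB
  ... | inj₂ (inj₁ (v , _ , _ , refl)) = contradiction
    (trans (sym odd) (trans (parity-⊕ ⁅ u ⁆ v) (cong not (parity-⁅⁆ u)))) λ ()
  ... | inj₂ (inj₂ 3≤D) with peerless MA MB 3≤D
  ... | X , X⊆D , X≠∅ , (y , y∈) , MX , MX′ with parity X in eq
  ...   | true  =
    let v , v∈ , Mv = exchangeOne (rs (p⊂q⇒∣p∣<∣q∣ (X⊆D , y , ∈△⊆⁻ X⊆D y∈))) MA MX eq
    in v , X⊆D v∈ , Mv
  ...   | false =
    let v , v∈ , Mv = exchangeOne (rs (△-⊆-< X⊆D X≠∅)) MA MX′
          (trans (parity-△ D X) (trans (cong (parity D xor_) eq)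
            (trans (Bool.xor-identityʳ (parity D)) odd)))
    in v , proj₁ (∈△⊆⁻ X⊆D v∈) , Mv

  -- Toggling two elements preserves parity, so only membership of the tail in `M` is at stake.
  -- There a pair containing the new element `zero` acts as a single toggle.
  evenLift-exchange : EvenExchange (EvenLift M)
  evenLift-exchange {A = A} {D = D} (MA , evenA) (MB , evenB) =
    go D (subst M (tail-△ A D) MB) evenD
    where
    evenD : parity D ≡ false
    evenD = trans (sym (trans (parity-△ A D) (cong (_xor parity D) evenA))) evenB

    lift : ∀ u v → M (Vec.tail (A ⊕ u ⊕ v)) → EvenLift M (A ⊕ u ⊕ v)
    lift u v Muv = Muv , trans (parity-⊕⊕ A u v) evenA

    go : ∀ D → M (Vec.tail A △ Vec.tail D) → parity D ≡ false → ∀ {u} → u ∈ D →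
      ∃ λ v → v ∈ D × v ≢ u × EvenLift M (A ⊕ u ⊕ v)
    -- The tail of the difference is odd here, because `zero` accounts for one element.
    go (true ∷ D) MB even Vec.here =
      let v , v∈D , Mv = exchangeOne (<-wellFounded _) MA MB
            (trans (sym (Bool.not-involutive (parity D))) (cong not even))
      in suc v , Vec.there v∈D , (λ ()) , lift zero (suc v)
           (subst M (sym (trans (tail-⊕-suc (A ⊕ zero) v) (cong (_⊕ v) (tail-⊕-zero A)))) Mv)
    go (t ∷ D) MB even {suc u} (Vec.there u∈D) with exchangeOneOrTwo (<-wellFounded _) MA MB u∈D
    ... | inj₂ (v , v∈D , v≢u , Muv) =
      suc v , Vec.there v∈D , v≢u ∘ Fin.suc-injective , lift (suc u) (suc v)
        (subst M (sym (trans (tail-⊕-suc (A ⊕ suc u) v) (cong (_⊕ v) (tail-⊕-suc A u)))) Muv)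
    -- Here `zero` lies in the difference and completes the single toggle to a pair.
    go (true ∷ D) MB even {suc u} (Vec.there u∈D) | inj₁ Mu =
      zero , Vec.here , (λ ()) , lift (suc u) zero
        (subst M (sym (trans (tail-⊕-zero (A ⊕ suc u)) (tail-⊕-suc A u))) Mu)
    -- Without `zero` the tail is even, so toggling `u` leaves an odd difference, and a further
    -- single exchange finds the partner.
    go (false ∷ D) MB even {suc u} (Vec.there u∈D) | inj₁ Mu =
      let v , v∈Du , Muv = exchangeOne (<-wellFounded _) Mu (subst M eq MB)
            (trans (parity-⊕ D u) (cong not even))
          v∈D , v≢u = ∈⊕-member⁻ u∈D v∈Du
      in suc v , Vec.there v∈D , v≢u ∘ Fin.suc-injective , lift (suc u) (suc v)
           (subst M (sym (trans (tail-⊕-suc (A ⊕ suc u) v) (cong (_⊕ v) (tail-⊕-suc A u)))) Muv)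
      where
      eq : Vec.tail A △ D ≡ (Vec.tail A ⊕ u) △ (D ⊕ u)
      eq = begin
        Vec.tail A △ D                        ≡⟨ △-interchange (Vec.tail A) D ⁅ u ⁆ ⟨
        (Vec.tail A △ ⁅ u ⁆) △ (D △ ⁅ u ⁆)    ≡⟨ cong₂ _△_ (△-⁅⁆ (Vec.tail A) u) (△-⁅⁆ D u) ⟩
        (Vec.tail A ⊕ u) △ (D ⊕ u)            ∎
        where open ≡-Reasoning

  peerless⇒strong : Decidable M → IsStrongΔMatroid M
  peerless⇒strong M? = record { isΔMatroid = isΔMatroid ; strongExchange = strongExchange }
    where
    isΔMatroid : IsΔMatroid M
    isΔMatroid {A} {B} MA MB {a} a∈
      with exchangeOneOrTwo (<-wellFounded _) MA (subst M (sym (△-cancelˡ A B)) MB) a∈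
    ... | inj₁ Ma = a , a∈ , subst M (sym (△-pair-self A a)) Ma
    ... | inj₂ (b , b∈ , b≢a , Mab) = b , b∈ , subst M (sym (△-pair A (b≢a ∘ sym))) Mab

    tail-single : ∀ s S (u : Fin n) → Vec.tail ((s ∷ S) ⊕ suc u ⊕ zero) ≡ S △ pair u u
    tail-single s S u = trans (tail-⊕-zero ((s ∷ S) ⊕ suc u))
      (trans (tail-⊕-suc (s ∷ S) u) (sym (△-pair-self S u)))

    tail-pair : ∀ s S {u v : Fin n} → v ≢ u → Vec.tail ((s ∷ S) ⊕ suc u ⊕ suc v) ≡ S △ pair u v
    tail-pair s S {u} {v} v≢u = trans (tail-⊕-suc ((s ∷ S) ⊕ suc u) v)
      (trans (cong (_⊕ v) (tail-⊕-suc (s ∷ S) u)) (sym (△-pair S (v≢u ∘ sym))))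

    lifted : ∀ {S} → M S → EvenLift M (parity S ∷ S)
    lifted {S} MS = MS , Bool.xor-same (parity S)

    evenLift? : Decidable (EvenLift M)
    evenLift? S = M? (Vec.tail S) ×-dec (parity S Bool.≟ false)

    strongExchange : ∀ {A B} → M A → M B → A ≢ B →
      ∃₂ λ a b → a ∈ A △ B × b ∈ A △ B × M (A △ pair a b) × M (B △ pair a b)
    strongExchange {A} {B} MA MB A≢B =
      let u , u∈ = △-Nonempty A≢B
          b , b∈ , b≢u , (MAb , _) , (MBb , _) =
            symmetricExchange {F = EvenLift M} (λ {A} {D} → evenLift-exchange {A} {D})
              {D = Â △ B̂} {A = Â} evenLift? (<-wellFounded _) (lifted MA)
              (subst (EvenLift M) (sym (△-cancelˡ Â B̂)) (lifted MB)) (Vec.there u∈)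
      in conclude u b u∈ b∈ b≢u MAb
           (subst (λ S → M (Vec.tail (S ⊕ suc u ⊕ b))) (△-cancelˡ Â B̂) MBb)
      where
      Â = parity A ∷ A
      B̂ = parity B ∷ B
      conclude : ∀ u b → u ∈ A △ B → b ∈ Â △ B̂ → b ≢ suc u →
        M (Vec.tail (Â ⊕ suc u ⊕ b)) → M (Vec.tail (B̂ ⊕ suc u ⊕ b)) →
        ∃₂ λ a b → a ∈ A △ B × b ∈ A △ B × M (A △ pair a b) × M (B △ pair a b)
      -- If the partner is the new element, a single toggle of `u` remains: the case of equal
      -- elements in the strong exchange.
      conclude u zero u∈ _ _ MAb MBb = u , u , u∈ , u∈ ,
        subst M (tail-single (parity A) A u) MAb , subst M (tail-single (parity B) B u) MBb
      conclude u (suc v) u∈ (Vec.there v∈) v≢u MAb MBb = u , v , u∈ , v∈ ,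
        subst M (tail-pair (parity A) A (v≢u ∘ cong suc)) MAb ,
        subst M (tail-pair (parity B) B (v≢u ∘ cong suc)) MBb

-- Antipodes and peerless equations

pair⊆ : a ∈ D → b ∈ D → pair a b ⊆ D
pair⊆ {a = a} {b = b} a∈D b∈D x∈ =
  [ ⁅⁆⊆ a∈D , ⁅⁆⊆ b∈D ]′ (x∈p∪q⁻ ⁅ a ⁆ ⁅ b ⁆ x∈)

∣∪∣≤ : (A B : Subset n) → ∣ A ∪ B ∣ ≤ ∣ A ∣ + ∣ B ∣
∣∪∣≤ []          []          = z≤n
∣∪∣≤ (true ∷ A)  (true ∷ B)  = s≤s (ℕ.≤-trans (∣∪∣≤ A B) (ℕ.+-monoʳ-≤ ∣ A ∣ (ℕ.n≤1+n ∣ B ∣)))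
∣∪∣≤ (true ∷ A)  (false ∷ B) = s≤s (∣∪∣≤ A B)
∣∪∣≤ (false ∷ A) (true ∷ B)  =
  ℕ.≤-trans (s≤s (∣∪∣≤ A B)) (ℕ.≤-reflexive (sym (ℕ.+-suc ∣ A ∣ ∣ B ∣)))
∣∪∣≤ (false ∷ A) (false ∷ B) = ∣∪∣≤ A B

∣pair∣≤2 : (a b : Fin n) → ∣ pair a b ∣ ≤ 2
∣pair∣≤2 a b = subst (∣ pair a b ∣ ≤_) (cong₂ _+_ (∣⁅x⁆∣≡1 a) (∣⁅x⁆∣≡1 b)) (∣∪∣≤ ⁅ a ⁆ ⁅ b ⁆)

-- A pair toggles at most two elements. Together with `△-pair-≢` this ensures that a strong exchange
-- leads to a new antipodal pair.
△-pair-≢-antipode : (A : Subset n) (a b : Fin n) → 3 ≤ ∣ A △ B ∣ → A △ pair a b ≢ B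
△-pair-≢-antipode A a b 3≤ refl = ℕ.<⇒≱ (s≤s (∣pair∣≤2 a b))
  (subst (λ X → 3 ≤ ∣ X ∣) (△-cancelˡ A (pair a b)) 3≤)

△-pair-≢ : (A : Subset n) (a b : Fin n) → A △ pair a b ≢ A
△-pair-≢ A a b eq = ∉⊥ (subst (a ∈_) pair≡⊥ (x∈p∪q⁺ (inj₁ (x∈⁅x⁆ a))))
  where
  pair≡⊥ : pair a b ≡ ⊥
  pair≡⊥ = trans (sym (△-cancelˡ A (pair a b))) (trans (cong (A △_) eq) (△-self A))

3≤△⇒≢ : 3 ≤ ∣ A △ B ∣ → A ≢ B
3≤△⇒≢ {n} {A} 3≤ refl with () ← subst (3 ≤_) (trans (cong ∣_∣ (△-self A)) (∣⊥∣≡0 n)) 3≤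

-- Each element of `X` lies in exactly one of `A` and `B`, and toggling it in both merely moves it
-- to the other set.
antipodes-△ : X ⊆ A △ B → Antipodes A B (A △ X , B △ X)
antipodes-△ {X = X} {A = A} {B = B} X⊆ = ⊆-antisym to from , △-interchange A B X
  where
  to : (A △ X) ∩ (B △ X) ⊆ A ∩ B
  to x∈ with x∈AX , x∈BX ← x∈p∩q⁻ (A △ X) (B △ X) x∈ with ∈△⁻ A X x∈AX | ∈△⁻ B X x∈BX
  ... | inj₁ (x∈A , _)   | inj₁ (x∈B , _)   = x∈p∩q⁺ (x∈A , x∈B)
  ... | inj₁ (_ , x∉X)   | inj₂ (_ , x∈X)   = contradiction x∈X x∉X
  ... | inj₂ (_ , x∈X)   | inj₁ (_ , x∉X)   = contradiction x∈X x∉X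
  ... | inj₂ (x∉A , x∈X) | inj₂ (x∉B , _) with ∈△⁻ A B (X⊆ x∈X)
  ...   | inj₁ (x∈A , _) = contradiction x∈A x∉A
  ...   | inj₂ (_ , x∈B) = contradiction x∈B x∉B
  from : A ∩ B ⊆ (A △ X) ∩ (B △ X)
  from {x} x∈ with x∈A , x∈B ← x∈p∩q⁻ A B x∈ = x∈p∩q⁺ (∈△⁺ˡ x∈A x∉X , ∈△⁺ˡ x∈B x∉X)
    where
    x∉X : x ∉ X
    x∉X x∈X with ∈△⁻ A B (X⊆ x∈X)
    ... | inj₁ (_ , x∉B) = x∉B x∈B
    ... | inj₂ (x∉A , _) = x∉A x∈A

-- `S` lies between `A ∩ B` and `A ∪ B`, so it can differ from `A` only where `B` does.
antipodes⇒△⊆ : Antipodes A B (S , T) → A △ S ⊆ A △ B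
antipodes⇒△⊆ {A = A} {B = B} {S = S} {T = T} (∩≡ , △≡) {x} x∈ with ∈△⁻ A S x∈
... | inj₁ (x∈A , x∉S) = ∈△⁺ˡ x∈A λ x∈B →
  x∉S (proj₁ (x∈p∩q⁻ S T (subst (x ∈_) (sym ∩≡) (x∈p∩q⁺ (x∈A , x∈B)))))
... | inj₂ (x∉A , x∈S) = subst (x ∈_) △≡ (∈△⁺ˡ x∈S λ x∈T →
  x∉A (proj₁ (x∈p∩q⁻ A B (subst (x ∈_) ∩≡ (x∈p∩q⁺ (x∈S , x∈T))))))

∈-antipodes⁺ : Antipodes I J (S , T) → (S , T) ∈ˡ antipodes I J
∈-antipodes⁺ {I = I} {J} {S} {T} =
  ∈-filter⁺ (antipodes? I J) (∈-cartesianProduct⁺ (∈-subsets S) (∈-subsets T))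

∈-antipodes⁻ : (S , T) ∈ˡ antipodes I J → Antipodes I J (S , T)
∈-antipodes⁻ {n} {I = I} {J} ST∈ =
  proj₂ (∈-filter⁻ (antipodes? I J) {xs = cartesianProduct (subsets n) (subsets n)} ST∈)

-- Monomials of antipodes and satisfaction of tropical equations

term : Subset n × Subset n → Monomial n
term (S , T) = x S ⊙ x T

x-self : (S : Subset n) → x S S ≡ 1
x-self S rewrite dec-true (S ≟ˢ S) refl = refl

x-other : S ≢ T → x T S ≡ 0
x-other {S = S} {T} S≢T rewrite dec-false (S ≟ˢ T) S≢T = refl

-- The exponent of the variable of `S` is positive on the right, hence also on the left.
term-≗⇒ : term (A , B) ≗ term (S , T) → S ≡ A ⊎ S ≡ B
term-≗⇒ {A = A} {B} {S} {T} eq with S ≟ˢ A | S ≟ˢ B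
... | yes S≡A | _       = inj₁ S≡A
... | no _    | yes S≡B = inj₂ S≡B
... | no S≢A  | no S≢B  = contradiction
  (trans (sym (cong₂ _+_ (x-other S≢A) (x-other S≢B)))
    (trans (eq S) (cong (_+ x T S) (x-self S)))) λ ()

module _ {M : SetSystem n ℓ} (M? : Decidable M) where

  ν-true : ν M? S ≡ true → M S
  ν-true {S = S} eq with M? S
  ... | yes MS = MS

  nonVanishing⁺ : M S → M T → NonVanishing (ν M?) (term (S , T))
  nonVanishing⁺ {S = S} {T} MS MT U 0<U with U ≟ˢ S | U ≟ˢ T
  ... | yes refl | _        = dec-true (M? S) MS
  ... | no _     | yes refl = dec-true (M? T) MT

  nonVanishing⁻ : NonVanishing (ν M?) (term (S , T)) → M S × M T
  nonVanishing⁻ {S = S} {T} nv =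
    ν-true (nv S (subst (λ k → 0 < k + x T S) (sym (x-self S)) (s≤s z≤n))) ,
    ν-true (nv T (subst (λ k → 0 < x S T + k) (sym (x-self T)) (ℕ.m≤n+m 1 (x S T))))

module _ (p : Point n) (as : List (Monomial n)) where

  private
    monomialSetoid = DecSetoid.setoid (monomialDecSetoid n)
    module ≗ = Setoid monomialSetoid
    open SetoidMembership monomialSetoid using () renaming (_∈_ to _∈≗_)

    survivors : List (Monomial n)
    survivors = filter (nonVanishing? p) (deduplicate _≗?_ as)

    survivors-unique : Unique monomialSetoid survivors
    survivors-unique = Unique.filter⁺ monomialSetoid (nonVanishing? p)
      (TropicalEquation.distinct (⨁ as))

    nonVanishing-resp : ∀ {a b} → a ≗ b → NonVanishing p a → NonVanishing p b
    nonVanishing-resp a≗b nv S = nv S ∘ subst (0 <_) (sym (a≗b S))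

    -- Deduplication may drop `a` in favour of another function with the same exponents, so
    -- membership is claimed only up to `≗`.
    ∈-survivors⁺ : ∀ {a} → a ∈ˡ as → NonVanishing p a → a ∈≗ survivors
    ∈-survivors⁺ a∈ =
      SetoidMembershipₚ.∈-filter⁺ monomialSetoid (nonVanishing? p) nonVanishing-resp
        (SetoidMembershipₚ.∈-deduplicate⁺ monomialSetoid _≗?_
          (λ c≗b a≗b U → trans (a≗b U) (sym (c≗b U))) (mapAny ≗.reflexive a∈))

    ∈-survivors⁻ : ∀ {a} → a ∈ˡ survivors → a ∈ˡ as × NonVanishing p a
    ∈-survivors⁻ a∈ with a∈′ , nv ← ∈-filter⁻ (nonVanishing? p) a∈ =
      ∈-deduplicate⁻ _≗?_ as a∈′ , nv

  -- Since `a` survives and the number of survivors is not one, there are at least two. The first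
  -- two differ, so one of them is not `a`.
  peer : p Satisfies ⨁ as → ∀ {a} → a ∈ˡ as → NonVanishing p a →
    ∃ λ b → b ∈ˡ as × NonVanishing p b × ¬ a ≗ b
  peer sat {a} a∈ nv = go survivors ∈-survivors⁻ survivors-unique sat (∈-survivors⁺ a∈ nv)
    where
    go : ∀ bs → (∀ {b} → b ∈ˡ bs → b ∈ˡ as × NonVanishing p b) → Unique monomialSetoid bs →
      length bs ≢ 1 → a ∈≗ bs → ∃ λ b → b ∈ˡ as × NonVanishing p b × ¬ a ≗ b
    go (_ ∷ [])    _    _              ≢1 _ = contradiction refl ≢1
    go (b ∷ c ∷ _) inbs ((b≉c ∷ _) ∷ _) _ _ with a ≗? b
    ... | no a≉b  = let b∈ , nv = inbs (here refl) in b , b∈ , nv , a≉b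
    ... | yes a≗b = let c∈ , nv = inbs (there (here refl)) in
      c , c∈ , nv , λ a≗c → b≉c (≗.trans (≗.sym a≗b) a≗c)

  -- The peer of a sole survivor would survive too and hence coincide with it.
  satisfies : (∀ {a} → a ∈ˡ as → NonVanishing p a →
    ∃ λ b → b ∈ˡ as × NonVanishing p b × ¬ a ≗ b) → p Satisfies ⨁ as
  satisfies peers = go survivors ∈-survivors⁻ ∈-survivors⁺
    where
    go : ∀ bs → (∀ {b} → b ∈ˡ bs → b ∈ˡ as × NonVanishing p b) →
      (∀ {b} → b ∈ˡ as → NonVanishing p b → b ∈≗ bs) → length bs ≢ 1
    go (a ∷ []) inbs outbs _ =
      let a∈ , nv = inbs (here refl)
          b , b∈ , nvb , a≉b = peers a∈ nv
      in case (outbs b∈ nvb) a≉b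
      where
      case : ∀ {b} → b ∈≗ (a ∷ []) → ¬ ¬ a ≗ b
      case (here b≗a) a≉b = a≉b (≗.sym b≗a)

-- Peerless antipode equations as exchange properties

module _ {M : SetSystem n ℓ} (M? : Decidable M) where

  -- Strong exchange toggles the same elements in both antipodes, so it moves to another antipodal
  -- pair of the same cube.
  strong⇒satisfies : IsStrongΔMatroid M → ∀ I J → 3 ≤ ∣ I △ J ∣ → ν M? Satisfies g I J
  strong⇒satisfies strong I J 3≤ = satisfies (ν M?) _ peers
    where
    peers : ∀ {m} → m ∈ˡ map term (antipodes I J) → NonVanishing (ν M?) m →
      ∃ λ m′ → m′ ∈ˡ map term (antipodes I J) × NonVanishing (ν M?) m′ × ¬ m ≗ m′
    peers m∈ nv
      with (S , T) , ST∈ , refl ← ∈-map⁻ term m∈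
      with MS , MT ← nonVanishing⁻ M? nv
      with ∩≡ , △≡ ← ∈-antipodes⁻ ST∈ =
      let 3≤ST = subst (λ D → 3 ≤ ∣ D ∣) (sym △≡) 3≤
          a , b , a∈ , b∈ , MS′ , MT′ = IsStrongΔMatroid.strongExchange strong MS MT (3≤△⇒≢ 3≤ST)
          ∩≡′ , △≡′ = antipodes-△ (pair⊆ a∈ b∈)
      in _ , ∈-map⁺ term (∈-antipodes⁺ (trans ∩≡′ ∩≡ , trans △≡′ △≡)) ,
         nonVanishing⁺ M? MS′ MT′ ,
         λ eq → [ △-pair-≢ S a b , △-pair-≢-antipode S a b 3≤ST ]′ (term-≗⇒ eq)

  satisfies⇒peerless : (∀ I J → 3 ≤ ∣ I △ J ∣ → ν M? Satisfies g I J) → Peerless M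
  satisfies⇒peerless sat {A} {D} MA MB 3≤D
    with m , m∈ , nv , m≉ ← peer (ν M?) _
           (sat A (A △ D) (subst (λ X → 3 ≤ ∣ X ∣) (sym (△-cancelˡ A D)) 3≤D))
           (∈-map⁺ term (∈-antipodes⁺ (refl , refl))) (nonVanishing⁺ M? MA MB)
    with (S , T) , ST∈ , refl ← ∈-map⁻ term m∈
    with MS , MT ← nonVanishing⁻ M? nv
    with anti@(_ , △≡) ← ∈-antipodes⁻ ST∈ =
    let T≡ = trans (sym (△-cancelˡ S T)) (cong (S △_) (trans △≡ (△-cancelˡ A D))) in
    A △ S , subst (A △ S ⊆_) (△-cancelˡ A D) (antipodes⇒△⊆ anti) ,
    △-Nonempty (λ A≡S → m≉ λ U → cong₂ (λ Y Z → term (Y , Z) U) A≡S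
      (trans (cong (_△ D) A≡S) (sym T≡))) ,
    -- If `D` were `A △ S`, then `S` and `T` would be the given antipodes in reverse order, with the
    -- same monomial by commutativity.
    △-Nonempty (λ D≡ →
      let S≡ = trans (sym (△-cancelˡ A S)) (cong (A △_) (sym D≡))
          A≡ = trans (sym (△-cancelʳ A D)) (trans (cong (_△ D) (sym S≡)) (sym T≡))
      in m≉ λ U → trans (ℕ.+-comm (x A U) (x (A △ D) U))
           (cong₂ (λ Y Z → term (Y , Z) U) (sym S≡) A≡)) ,
    subst M (sym (△-cancelˡ A S)) MS ,
    subst M (trans T≡ (sym (trans (cong (A △_) (trans (△-comm D (A △ S)) (△-assoc A S D)))
      (△-cancelˡ A (S △ D))))) MT

corollary4p2 : ∀ {ℓ : Level} (n : ℕ) (M : SetSystem n ℓ) (M? : Decidable M) →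
    IsStrongΔMatroid M ⇔ (∀ f → 𝒢 n f → (ν M?) Satisfies f)
corollary4p2 n M M? = mk⇔
  (λ { strong _ (I , J , 3≤ , refl) → strong⇒satisfies M? strong I J 3≤ })
  (λ sat → peerless⇒strong (satisfies⇒peerless M? λ I J 3≤ → sat (g I J) (I , J , 3≤ , refl)) M?)
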